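{- For $n\ge 2$, let $\mathcal M^{\mathrm d}(n)$ be the number of MAB pairs $(u,v)$ of binary words with $|u|=|v|=n$ and $\mathrm{lsb}(u,v)+\mathrm{lsb}(v,u)\le n$. Then $$\mathcal M^{\mathrm d}(n)=\sum_{i=1}^{n-1}\sum_{j=1}^{n-i} D(2n-2i,\,j)\,D(2i,\,i).$$
   Context: Let $\Sigma=\{a,b\}$. For a word $w$ and a letter $c$, $|w|_c$ denotes the number of occurrences of $c$ in $w$. Two words $x,y$ are abelian equivalent, written $x\sim_{\mathrm{abl}}y$, if $|x|_c=|y|_c$ for all $c\in\Sigma$. For words $u,v$: a pair $(x,y)$ is an internal abelian-border of $(u,v)$ if $x$ is a nonempty proper suffix of $u$, $y$ is a proper prefix of $v$, and $x\sim_{\mathrm{abl}}y$; it is an external abelian-border of $(u,v)$ if $x$ is a nonempty proper prefix of $u$, $y$ is a proper suffix of $v$, and $x\sim_{\mathrm{abl}}y$. The pair $(u,v)$ is mutually abelian-bordered (MAB) if it has both an internal and an external abelian-border, and mutually abelian-unbordered (MAU) if it has neither. If $(u,v)$ has an internal abelian-border, $\mathrm{sb}(u,v)$ denotes its internal abelian-border $(x,y)$ of minimal length and $\mathrm{lsb}(u,v)=|x|$ is that minimal length. A binary word $w$ of length $m$ has an abelian-border of length $k$ ($1\le k\le m-1$) if its prefix of length $k$ is abelian equivalent to its suffix of length $k$. $D(m,k)$ denotes the number of binary words of length $m$ whose shortest abelian-border has length exactly $k$. -}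

module Defs where

open import Data.List.Base
  using (List; []; _∷_; _++_; map; length; filter; take; drop; inits; tails;
         cartesianProduct; upTo)
open import Data.List.Membership.Propositional using (_∈_; lose; find)
open import Data.List.Membership.Propositional.Properties using (∈-map⁺)
open import Data.List.Properties using (≡-dec)
open import Data.List.Relation.Binary.Pointwise using (Pointwise-≡⇒≡)
open import Data.List.Relation.Binary.Prefix.Heterogeneous
  using (Prefix; []; _∷_)
open import Data.List.Relation.Binary.Prefix.Heterogeneous.Properties
  using (prefix?)
open import Data.List.Relation.Binary.Suffix.Heterogeneous
  using (Suffix; here; there)
open import Data.List.Relation.Binary.Suffix.Heterogeneous.Properties
  using (suffix?)
open import Data.List.Relation.Unary.All as All using (All; all?)
open import Data.List.Relation.Unary.Any as Any using (Any; any?)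
open import Data.Nat.Base using (ℕ; zero; suc; _+_; _∸_; _≤_; _<_; s≤s)
open import Data.Nat.ListAction using (sum)
open import Data.Nat.Properties as ℕ
  using (_≤?_; _<?_; anyUpTo?; allUpTo?; m+n≤o⇒m≤o; m+n≤o⇒n≤o)
open import Data.Product.Base using (_×_; _,_; ∃; ∃₂; uncurry)
open import Relation.Binary.Definitions using (DecidableEquality)
open import Relation.Binary.PropositionalEquality using (_≡_; _≢_; refl)
open import Relation.Nullary.Decidable
  using (Dec; yes; no; map′; _×-dec_; _→-dec_; ¬?)
open import Relation.Nullary.Negation using (¬_)

data Letter : Set where
  a b : Letter

infix 4 _≟_

_≟_ : DecidableEquality Letter
a ≟ a = yes refl
a ≟ b = no λ ()
b ≟ a = no λ ()
b ≟ b = yes refl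

Word : Set
Word = List Letter

-- Every word of length m, exactly once.
words : ℕ → List Word
words zero    = [] ∷ []
words (suc m) = map (a ∷_) (words m) ++ map (b ∷_) (words m)

∣_∣[_] : Word → Letter → ℕ
∣ w ∣[ c ] = length (filter (_≟ c) w)

infix 4 _∼_ _∼?_

_∼_ : Word → Word → Set
x ∼ y = ∀ c → ∣ x ∣[ c ] ≡ ∣ y ∣[ c ]

ProperPrefix ProperSuffix : Word → Word → Set
ProperPrefix x u = Prefix _≡_ x u × x ≢ u
ProperSuffix x u = Suffix _≡_ x u × x ≢ u

InternalBorder ExternalBorder : (u v x y : Word) → Set
InternalBorder u v x y = x ≢ [] × ProperSuffix x u × ProperPrefix y v × x ∼ y
ExternalBorder u v x y = x ≢ [] × ProperPrefix x u × ProperSuffix y v × x ∼ y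

MAB : Word → Word → Set
MAB u v = ∃₂ (InternalBorder u v) × ∃₂ (ExternalBorder u v)

-- (x , y) is the internal border sb(u,v) of minimal length.
Sb : (u v x y : Word) → Set
Sb u v x y = InternalBorder u v x y
           × (∀ x′ y′ → InternalBorder u v x′ y′ → length x ≤ length x′)

-- The graph of the partial function lsb: Lsb u v k says that lsb(u,v) is
-- defined and equal to k.
Lsb : (u v : Word) → ℕ → Set
Lsb u v k = ∃₂ λ x y → Sb u v x y × length x ≡ k

MABᵈ : ℕ → Word → Word → Set
MABᵈ n u v = MAB u v × ∃₂ λ i j → Lsb u v i × Lsb v u j × i + j ≤ n

HasBorder : Word → ℕ → Set
HasBorder w k = 1 ≤ k × k < length w × take k w ∼ drop (length w ∸ k) w

ShortestBorder : Word → ℕ → Set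
ShortestBorder w k = HasBorder w k × (∀ {j} → j < k → ¬ HasBorder w j)

_∼?_ : ∀ x y → Dec (x ∼ y)
x ∼? y = map′ (λ { (p , q) a → p ; (p , q) b → q }) (λ e → e a , e b)
  ((∣ x ∣[ a ] ℕ.≟ ∣ y ∣[ a ]) ×-dec (∣ x ∣[ b ] ℕ.≟ ∣ y ∣[ b ]))

properPrefix? : ∀ x u → Dec (ProperPrefix x u)
properPrefix? x u = prefix? _≟_ x u ×-dec ¬? (≡-dec _≟_ x u)

properSuffix? : ∀ x u → Dec (ProperSuffix x u)
properSuffix? x u = suffix? _≟_ x u ×-dec ¬? (≡-dec _≟_ x u)

internalBorder? : ∀ u v x y → Dec (InternalBorder u v x y)
internalBorder? u v x y = ¬? (≡-dec _≟_ x []) ×-dec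
  (properSuffix? x u ×-dec (properPrefix? y v ×-dec (x ∼? y)))

externalBorder? : ∀ u v x y → Dec (ExternalBorder u v x y)
externalBorder? u v x y = ¬? (≡-dec _≟_ x []) ×-dec
  (properPrefix? x u ×-dec (properSuffix? y v ×-dec (x ∼? y)))

prefix⇒∈inits : ∀ {x u : Word} → Prefix _≡_ x u → x ∈ inits u
prefix⇒∈inits []         = Any.here refl
prefix⇒∈inits (refl ∷ p) with prefix⇒∈inits p
... | Any.here refl = Any.there (Any.here refl)
... | Any.there q   = Any.there (Any.there (∈-map⁺ _ q))

suffix⇒∈tails : ∀ {x u : Word} → Suffix _≡_ x u → x ∈ tails u
suffix⇒∈tails (here e) with refl ← Pointwise-≡⇒≡ e = Any.here refl
suffix⇒∈tails (there s) = Any.there (suffix⇒∈tails s)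

module _ {P : Word → Word → Set} (P? : ∀ x y → Dec (P x y)) (xs ys : List Word)
         (bound : ∀ {x y} → P x y → x ∈ xs × y ∈ ys) where

  ∃₂? : Dec (∃₂ P)
  ∃₂? = map′ to from (any? (λ x → any? (P? x) ys) xs)
    where
    to : Any (λ x → Any (P x) ys) xs → ∃₂ P
    to p with x , _ , q ← find p with y , _ , r ← find q = x , y , r
    from : ∃₂ P → Any (λ x → Any (P x) ys) xs
    from (x , y , p) with x∈ , y∈ ← bound p = lose x∈ (lose y∈ p)

  ∀₂? : ∀ {Q : Word → Set} → (∀ x → Dec (Q x)) → Dec (∀ x y → P x y → Q x)
  ∀₂? {Q} Q? = map′ to from (all? (λ x → all? (dec x) ys) xs)
    where
    dec : ∀ x y → Dec (P x y → Q x)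
    dec x y = P? x y →-dec Q? x
    to : All (λ x → All (λ y → P x y → Q x) ys) xs → ∀ x y → P x y → Q x
    to h x y p with x∈ , y∈ ← bound p = All.lookup (All.lookup h x∈) y∈ p
    from : (∀ x y → P x y → Q x) → All (λ x → All (λ y → P x y → Q x) ys) xs
    from h = All.tabulate λ {x} _ → All.tabulate λ {y} _ → h x y

internal-bound : ∀ u v {x y} → InternalBorder u v x y → x ∈ tails u × y ∈ inits v
internal-bound u v (_ , (s , _) , (p , _) , _) = suffix⇒∈tails s , prefix⇒∈inits p

external-bound : ∀ u v {x y} → ExternalBorder u v x y → x ∈ inits u × y ∈ tails v
external-bound u v (_ , (p , _) , (s , _) , _) = prefix⇒∈inits p , suffix⇒∈tails s

mab? : ∀ u v → Dec (MAB u v)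
mab? u v = ∃₂? (internalBorder? u v) (tails u) (inits v) (internal-bound u v)
     ×-dec ∃₂? (externalBorder? u v) (inits u) (tails v) (external-bound u v)

sb? : ∀ u v x y → Dec (Sb u v x y)
sb? u v x y = internalBorder? u v x y ×-dec
  ∀₂? (internalBorder? u v) (tails u) (inits v) (internal-bound u v)
      (λ x′ → length x ≤? length x′)

lsb? : ∀ u v k → Dec (Lsb u v k)
lsb? u v k = ∃₂? (λ x y → sb? u v x y ×-dec (length x ℕ.≟ k))
  (tails u) (inits v) λ { ((i , _) , _) → internal-bound u v i }

mabᵈ? : ∀ n u v → Dec (MABᵈ n u v)
mabᵈ? n u v = mab? u v ×-dec map′
  (λ { (i , _ , j , _ , p) → i , j , p })
  (λ { (i , j , p@(_ , _ , i+j≤n)) →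
         i , s≤s (m+n≤o⇒m≤o i i+j≤n) , j , s≤s (m+n≤o⇒n≤o i i+j≤n) , p })
  (anyUpTo? (λ i → anyUpTo? (λ j →
     lsb? u v i ×-dec (lsb? v u j ×-dec (i + j ≤? n))) (suc n)) (suc n))

hasBorder? : ∀ w k → Dec (HasBorder w k)
hasBorder? w k = (1 ≤? k) ×-dec
  ((k <? length w) ×-dec (take k w ∼? drop (length w ∸ k) w))

shortestBorder? : ∀ w k → Dec (ShortestBorder w k)
shortestBorder? w k =
  hasBorder? w k ×-dec allUpTo? (λ j → ¬? (hasBorder? w j)) k

𝓜ᵈ : ℕ → ℕ
𝓜ᵈ n = length (filter (uncurry (mabᵈ? n)) (cartesianProduct (words n) (words n)))

D : ℕ → ℕ → ℕ
D m k = length (filter (λ w → shortestBorder? w k) (words m))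

-- f 1 + f 2 + ⋯ + f m
∑₁ : ℕ → (ℕ → ℕ) → ℕ
∑₁ m f = sum (map (λ i → f (suc i)) (upTo m))

{-# OPTIONS --safe #-}

-- Cut u = p ++ s and v = q ++ r with |s| = |q| = i = lsb(u,v).  Up to length i
-- the internal borders of (u,v) are the borders of q ++ s, and up to length
-- n - i those of (v,u) are the borders of p ++ r.  As lsb(v,u) = j ≤ n - i,
-- re-pairing the four factors sends the pairs (u,v) with these two values
-- bijectively to pairs of words counted by D(2i,i) and D(2n-2i,j).
module Submission where

open import Defs
open import Data.Bool.Base using (if_then_else_)
open import Data.List.Base
  using (List; []; _∷_; _++_; map; length; filter; take; drop; upTo; cartesianProduct)
open import Data.List.Membership.Propositional using (_∈_)
open import Data.List.Membership.Propositional.Properties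
  using (∈-++⁻; ∈-map⁻; ∈-upTo⁺; ∈-upTo⁻)
open import Data.List.Properties using (length-++; length-take; length-drop; map-++; map-∘; ++-identityʳ)
open import Data.List.Relation.Binary.Pointwise using (Pointwise-≡⇒≡; ≡⇒Pointwise-≡)
import Data.List.Relation.Binary.Prefix.Heterogeneous as Prefix
import Data.List.Relation.Binary.Suffix.Heterogeneous as Suffix
open import Data.List.Relation.Unary.All as All using ()
open import Data.List.Relation.Unary.AllPairs using (_∷_)
open import Data.List.Relation.Unary.Any using (here; there)
open import Data.List.Relation.Unary.Unique.Propositional using (Unique)
open import Data.List.Relation.Unary.Unique.Propositional.Properties using (upTo⁺)
open import Data.Nat.Base
  using (ℕ; zero; suc; _+_; _∸_; _*_; _≤_; _<_; z≤n; s≤s; s≤s⁻¹)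
open import Data.Nat.ListAction using (sum)
open import Data.Nat.ListAction.Properties using (sum-++)
open import Data.Nat.Properties
open import Algebra.Properties.CommutativeSemigroup +-commutativeSemigroup
  using (interchange)
open import Data.Product.Base using (_×_; _,_; uncurry)
open import Data.Sum.Base using (inj₁; inj₂)
open import Function.Base using (_∘_)
open import Function.Bundles using (_⇔_; mk⇔; Equivalence)
open import Relation.Binary.PropositionalEquality
  using (_≡_; _≢_; refl; sym; trans; cong; cong₂; subst; module ≡-Reasoning)
open import Relation.Nullary.Decidable using (Dec; does; yes; no; does-⇔; dec-true; dec-false)
open import Relation.Nullary.Negation using (¬_; contradiction)

open Equivalence using (to; from)

-- Finite sums over lists

∑ : {A : Set} → List A → (A → ℕ) → ℕ
∑ xs f = sum (map f xs)

-- Iverson bracket. It reads only `does`, so equivalent propositions get equal values whatever their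
-- deciders.
⟦_⟧ : {P : Set} → Dec P → ℕ
⟦ P? ⟧ = if does P? then 1 else 0

module _ {P : Set} (P? : Dec P) where

  ⟦⟧-true : P → ⟦ P? ⟧ ≡ 1
  ⟦⟧-true p = cong (if_then 1 else 0) (dec-true P? p)

  ⟦⟧-false : ¬ P → ⟦ P? ⟧ ≡ 0
  ⟦⟧-false ¬p = cong (if_then 1 else 0) (dec-false P? ¬p)

  ⟦⟧-⇔ : {Q : Set} (Q? : Dec Q) → P ⇔ Q → ⟦ P? ⟧ ≡ ⟦ Q? ⟧
  ⟦⟧-⇔ Q? P⇔Q = cong (if_then 1 else 0) (does-⇔ P⇔Q P? Q?)

module _ {A : Set} where

  ∑-cong : ∀ (xs : List A) {f g : A → ℕ} → (∀ {x} → x ∈ xs → f x ≡ g x) → ∑ xs f ≡ ∑ xs g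
  ∑-cong []       e = refl
  ∑-cong (x ∷ xs) e = cong₂ _+_ (e (here refl)) (∑-cong xs (e ∘ there))

  ∑-zero : ∀ (xs : List A) {f : A → ℕ} → (∀ {x} → x ∈ xs → f x ≡ 0) → ∑ xs f ≡ 0
  ∑-zero []       e = refl
  ∑-zero (x ∷ xs) e = cong₂ _+_ (e (here refl)) (∑-zero xs (e ∘ there))

  ∑-+ : ∀ (xs : List A) (f g : A → ℕ) → ∑ xs (λ x → f x + g x) ≡ ∑ xs f + ∑ xs g
  ∑-+ []       f g = refl
  ∑-+ (x ∷ xs) f g = trans (cong (f x + g x +_) (∑-+ xs f g)) (interchange (f x) (g x) _ _)

  ∑-*ˡ : ∀ (xs : List A) c (f : A → ℕ) → ∑ xs (λ x → c * f x) ≡ c * ∑ xs f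
  ∑-*ˡ []       c f = sym (*-zeroʳ c)
  ∑-*ˡ (x ∷ xs) c f = trans (cong (c * f x +_) (∑-*ˡ xs c f)) (sym (*-distribˡ-+ c (f x) _))

  ∑-*ʳ : ∀ (xs : List A) (f : A → ℕ) c → ∑ xs (λ x → f x * c) ≡ ∑ xs f * c
  ∑-*ʳ []       f c = refl
  ∑-*ʳ (x ∷ xs) f c = trans (cong (f x * c +_) (∑-*ʳ xs f c)) (sym (*-distribʳ-+ c (f x) _))

  ∑-++ : ∀ (xs ys : List A) (f : A → ℕ) → ∑ (xs ++ ys) f ≡ ∑ xs f + ∑ ys f
  ∑-++ xs ys f = trans (cong sum (map-++ f xs ys)) (sum-++ (map f xs) (map f ys))

  ∑-map : ∀ {B : Set} (xs : List B) (h : B → A) (f : A → ℕ) → ∑ (map h xs) f ≡ ∑ xs (f ∘ h)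
  ∑-map xs h f = cong sum (sym (map-∘ xs))

  ∑-single : ∀ {xs : List A} {z} {f : A → ℕ} → Unique xs → z ∈ xs →
             (∀ {x} → x ≢ z → f x ≡ 0) → ∑ xs f ≡ f z
  ∑-single {x ∷ xs} {f = f} (x∉ ∷ _) (here refl) e =
    trans (cong (f x +_) (∑-zero xs λ y∈ → e λ y≡x → All.lookup x∉ y∈ (sym y≡x))) (+-identityʳ (f x))
  ∑-single {x ∷ xs} (x∉ ∷ u) (there z∈) e =
    cong₂ _+_ (e (All.lookup x∉ z∈)) (∑-single u z∈ e)

  length-filter≡∑ : {P : A → Set} (P? : ∀ x → Dec (P x)) (xs : List A) →
                    length (filter P? xs) ≡ ∑ xs (λ x → ⟦ P? x ⟧)
  length-filter≡∑ P? []       = refl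
  length-filter≡∑ P? (x ∷ xs) with P? x
  ... | yes _ = cong suc (length-filter≡∑ P? xs)
  ... | no  _ = length-filter≡∑ P? xs

module _ {A B : Set} where

  ∑-comm : ∀ (xs : List A) (ys : List B) (f : A → B → ℕ) →
           ∑ xs (λ x → ∑ ys (f x)) ≡ ∑ ys (λ y → ∑ xs λ x → f x y)
  ∑-comm []       ys f = sym (∑-zero ys λ _ → refl)
  ∑-comm (x ∷ xs) ys f =
    trans (cong (∑ ys (f x) +_) (∑-comm xs ys f)) (sym (∑-+ ys (f x) _))

  ∑-cartesianProduct : ∀ (xs : List A) (ys : List B) (f : A × B → ℕ) →
    ∑ (cartesianProduct xs ys) f ≡ ∑ xs (λ x → ∑ ys λ y → f (x , y))
  ∑-cartesianProduct []       ys f = refl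
  ∑-cartesianProduct (x ∷ xs) ys f =
    trans (∑-++ (map (x ,_) ys) (cartesianProduct xs ys) f)
          (cong₂ _+_ (∑-map ys (x ,_) f) (∑-cartesianProduct xs ys f))

-- Sums over all words of a given length

∑-words-suc : ∀ m (f : Word → ℕ) →
  ∑ (words (suc m)) f ≡ ∑ (words m) (f ∘ (a ∷_)) + ∑ (words m) (f ∘ (b ∷_))
∑-words-suc m f =
  trans (∑-++ (map (a ∷_) (words m)) (map (b ∷_) (words m)) f)
        (cong₂ _+_ (∑-map (words m) (a ∷_) f) (∑-map (words m) (b ∷_) f))

-- Cutting after `m` letters is a bijection from words of length `m + k` to pairs of words. Stated
-- for sums, it turns the re-pairing of factors into a rearrangement of iterated sums.
∑-words-+ : ∀ m k (f : Word → ℕ) →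
  ∑ (words (m + k)) f ≡ ∑ (words m) (λ x → ∑ (words k) λ y → f (x ++ y))
∑-words-+ zero    k f = sym (+-identityʳ _)
∑-words-+ (suc m) k f = begin
  ∑ (words (suc m + k)) f
    ≡⟨ ∑-words-suc (m + k) f ⟩
  ∑ (words (m + k)) (f ∘ (a ∷_)) + ∑ (words (m + k)) (f ∘ (b ∷_))
    ≡⟨ cong₂ _+_ (∑-words-+ m k _) (∑-words-+ m k _) ⟩
  ∑ (words m) (λ x → ∑ (words k) λ y → f (a ∷ x ++ y)) +
  ∑ (words m) (λ x → ∑ (words k) λ y → f (b ∷ x ++ y))
    ≡⟨ ∑-words-suc m _ ⟨
  ∑ (words (suc m)) (λ x → ∑ (words k) λ y → f (x ++ y)) ∎
  where open ≡-Reasoning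

length-words : ∀ m {w} → w ∈ words m → length w ≡ m
length-words zero    (here refl) = refl
length-words (suc m) w∈ with ∈-++⁻ (map (a ∷_) (words m)) w∈
... | inj₁ p with _ , x∈ , refl ← ∈-map⁻ (a ∷_) p = cong suc (length-words m x∈)
... | inj₂ p with _ , x∈ , refl ← ∈-map⁻ (b ∷_) p = cong suc (length-words m x∈)

-- Borders in terms of take and drop

∼-sym : ∀ {x y} → x ∼ y → y ∼ x
∼-sym e c = sym (e c)

length≡∣∣ : ∀ w → length w ≡ ∣ w ∣[ a ] + ∣ w ∣[ b ]
length≡∣∣ []      = refl
length≡∣∣ (a ∷ w) = cong suc (length≡∣∣ w)
length≡∣∣ (b ∷ w) = trans (cong suc (length≡∣∣ w)) (sym (+-suc _ _))

-- Over two letters the length is the sum of the letter counts. One number can therefore measure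
-- both components of a border.
∼⇒length≡ : ∀ {x y} → x ∼ y → length x ≡ length y
∼⇒length≡ {x} {y} e =
  trans (length≡∣∣ x) (trans (cong₂ _+_ (e a) (e b)) (sym (length≡∣∣ y)))

module _ {A : Set} where

  -- Has the form of the suffix in `HasBorder`, so that the two agree by definition.
  takeLast : ℕ → List A → List A
  takeLast k xs = drop (length xs ∸ k) xs

  take-++ : ∀ {k} (xs ys : List A) → k ≤ length xs → take k (xs ++ ys) ≡ take k xs
  take-++ {zero}  xs       ys _ = refl
  take-++ {suc k} (x ∷ xs) ys p = cong (x ∷_) (take-++ xs ys (s≤s⁻¹ p))

  take-length-++ : ∀ (xs ys : List A) → take (length xs) (xs ++ ys) ≡ xs
  take-length-++ []       ys = refl
  take-length-++ (x ∷ xs) ys = cong (x ∷_) (take-length-++ xs ys)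

  drop-length-++ : ∀ (xs : List A) m ys → drop (length xs + m) (xs ++ ys) ≡ drop m ys
  drop-length-++ []       m ys = refl
  drop-length-++ (x ∷ xs) m ys = drop-length-++ xs m ys

  takeLast-++ : ∀ {k} (xs ys : List A) → k ≤ length ys → takeLast k (xs ++ ys) ≡ takeLast k ys
  takeLast-++ {k} xs ys p = trans
    (cong (λ m → drop m (xs ++ ys))
      (trans (cong (_∸ k) (length-++ xs)) (+-∸-assoc (length xs) p)))
    (drop-length-++ xs (length ys ∸ k) ys)

  takeLast-length : ∀ (xs : List A) → takeLast (length xs) xs ≡ xs
  takeLast-length xs = cong (λ m → drop m xs) (n∸n≡0 (length xs))

  length-takeLast : ∀ {k} (xs : List A) → k ≤ length xs → length (takeLast k xs) ≡ k
  length-takeLast {k} xs p = trans (length-drop (length xs ∸ k) xs) (m∸[m∸n]≡n p)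

  take-Prefix : ∀ k (xs : List A) → Prefix.Prefix _≡_ (take k xs) xs
  take-Prefix zero    xs       = Prefix.[]
  take-Prefix (suc k) []       = Prefix.[]
  take-Prefix (suc k) (x ∷ xs) = refl Prefix.∷ take-Prefix k xs

  drop-Suffix : ∀ k (xs : List A) → Suffix.Suffix _≡_ (drop k xs) xs
  drop-Suffix zero    xs       = Suffix.here (≡⇒Pointwise-≡ refl)
  drop-Suffix (suc k) []       = Suffix.here (≡⇒Pointwise-≡ refl)
  drop-Suffix (suc k) (x ∷ xs) = Suffix.there (drop-Suffix k xs)

  length>0 : ∀ {xs : List A} → xs ≢ [] → 0 < length xs
  length>0 {[]}    ne = contradiction refl ne
  length>0 {_ ∷ _} ne = s≤s z≤n

-- Borders of a pair, indexed by length

properPrefix⇒take : ∀ {y v} → ProperPrefix y v → take (length y) v ≡ y × length y < length v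
properPrefix⇒take {y} (p , y≢v) with Prefix.toView p
... | e Prefix.++ z with refl ← Pointwise-≡⇒≡ e = take-length-++ y z , shorter z y≢v
  where
  shorter : ∀ z → y ≢ y ++ z → length y < length (y ++ z)
  shorter []      ne = contradiction (sym (++-identityʳ y)) ne
  shorter (c ∷ z) _  = subst (length y <_) (sym (length-++ y)) (m<m+n (length y) (s≤s z≤n))

properSuffix⇒takeLast : ∀ {x u} → ProperSuffix x u → takeLast (length x) u ≡ x × length x < length u
properSuffix⇒takeLast {x} (s , x≢u) with Suffix.toView s
... | z Suffix.++ e with refl ← Pointwise-≡⇒≡ e =
  trans (takeLast-++ z x ≤-refl) (takeLast-length x) , shorter z x≢u
  where
  shorter : ∀ z → x ≢ z ++ x → length x < length (z ++ x)
  shorter []      ne = contradiction refl ne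
  shorter (c ∷ z) _  = s≤s (subst (length x ≤_) (sym (length-++ z)) (m≤n+m _ (length z)))

-- A suffix of `u` and a prefix of `v` are determined by their lengths, so one number `k` stands for
-- a whole internal border.
record InternalAt (u v : Word) (k : ℕ) : Set where
  constructor internalAt
  field
    positive : 1 ≤ k
    properˡ  : k < length u
    properʳ  : k < length v
    matching : takeLast k u ∼ take k v

InternalBorder⇒InternalAt : ∀ {u v x y} → InternalBorder u v x y → InternalAt u v (length x)
InternalBorder⇒InternalAt {u} {v} {x} {y} (x≢[] , s , p , x∼y)
  with properSuffix⇒takeLast s | properPrefix⇒take p
-- Abelian equivalence gives `y` the length of `x`, so both components are cut at the same `k`.
... | sx , x<u | py , y<v rewrite sym (∼⇒length≡ {x} {y} x∼y) =
  internalAt (length>0 x≢[]) x<u y<v λ c →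
    trans (cong ∣_∣[ c ] sx) (trans (x∼y c) (cong ∣_∣[ c ] (sym py)))

InternalAt⇒InternalBorder : ∀ {u v k} → InternalAt u v k →
                            InternalBorder u v (takeLast k u) (take k v)
InternalAt⇒InternalBorder {u} {v} {k} (internalAt k>0 k<u k<v m) =
    (λ e → <⇒≢ k>0 (sym (trans (sym ∣x∣) (cong length e))))
  , (drop-Suffix (length u ∸ k) u , λ e → <⇒≢ k<u (trans (sym ∣x∣) (cong length e)))
  , (take-Prefix k v , λ e → <⇒≢ k<v (trans (sym ∣y∣) (cong length e)))
  , m
  where
  ∣x∣ : length (takeLast k u) ≡ k
  ∣x∣ = length-takeLast u (<⇒≤ k<u)
  ∣y∣ : length (take k v) ≡ k
  ∣y∣ = trans (length-take k v) (m≤n⇒m⊓n≡m (<⇒≤ k<v))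

-- Trades minimality over pairs of words for minimality over lengths, the form that `ShortestBorder`
-- has.
Lsb⇔ : ∀ {u v k} → Lsb u v k ⇔ (InternalAt u v k × (∀ {j} → j < k → ¬ InternalAt u v j))
Lsb⇔ {u} {v} {k} = mk⇔ fwd bwd
  where
  length-at : ∀ {j} → InternalAt u v j → length (takeLast j u) ≡ j
  length-at at = length-takeLast u (<⇒≤ (InternalAt.properˡ at))

  fwd : Lsb u v k → InternalAt u v k × (∀ {j} → j < k → ¬ InternalAt u v j)
  fwd (x , y , (ib , min) , refl) = InternalBorder⇒InternalAt ib , λ j<k at →
    <⇒≱ j<k (subst (length x ≤_) (length-at at) (min _ _ (InternalAt⇒InternalBorder at)))

  bwd : InternalAt u v k × (∀ {j} → j < k → ¬ InternalAt u v j) → Lsb u v k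
  bwd (at , min) = _ , _ , (InternalAt⇒InternalBorder at ,
    λ _ _ ib → subst (_≤ _) (sym (length-at at))
      (≮⇒≥ λ l<k → min l<k (InternalBorder⇒InternalAt ib))) , length-at at

-- Re-pairing the factors of two cut words

module _ (p s q r : Word) (0<p : 0 < length p) (0<r : 0 < length r) where

  -- Within these bounds the last `k` letters of `p ++ s` lie in `s` and the first `k` of `q ++ r`
  -- lie in `q`, so `q ++ s` shows the same two factors. That `p` and `r` are nonempty makes the
  -- internal border proper.
  InternalAt⇔HasBorder : ∀ {k} → k ≤ length s → k ≤ length q →
                         InternalAt (p ++ s) (q ++ r) k ⇔ HasBorder (q ++ s) k
  InternalAt⇔HasBorder {k} k≤s k≤q = mk⇔
    (λ { (internalAt k>0 _ _ m) → k>0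
       , subst (k <_) (sym (length-++ q))
           -- Properness in `q ++ s` comes from `k < k + k`, as `k` is positive.
           (<-≤-trans (m<m+n k k>0) (+-mono-≤ k≤q k≤s))
       , λ c → trans (cong ∣_∣[ c ] (trans (take-++ q s k≤q) (sym (take-++ q r k≤q))))
           (trans (sym (m c))
             (cong ∣_∣[ c ] (trans (takeLast-++ p s k≤s) (sym (takeLast-++ q s k≤s))))) })
    (λ { (k>0 , _ , m) → internalAt k>0
       (subst (k <_) (sym (length-++ p)) (≤-<-trans k≤s (m<n+m (length s) 0<p)))
       (subst (k <_) (sym (length-++ q)) (≤-<-trans k≤q (m<m+n (length q) 0<r)))
       λ c → trans (cong ∣_∣[ c ] (trans (takeLast-++ p s k≤s) (sym (takeLast-++ q s k≤s))))
           (trans (sym (m c))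
             (cong ∣_∣[ c ] (trans (take-++ q s k≤q) (sym (take-++ q r k≤q))))) })

  -- Every `j` below `k` meets the same length bounds, so the equivalence transfers the absence of
  -- shorter borders along with the border itself.
  Lsb⇔ShortestBorder : ∀ {k} → k ≤ length s → k ≤ length q →
                       Lsb (p ++ s) (q ++ r) k ⇔ ShortestBorder (q ++ s) k
  Lsb⇔ShortestBorder {k} k≤s k≤q = mk⇔ fwd bwd
    where
    equiv : ∀ {j} → j ≤ k → InternalAt (p ++ s) (q ++ r) j ⇔ HasBorder (q ++ s) j
    equiv j≤k = InternalAt⇔HasBorder (≤-trans j≤k k≤s) (≤-trans j≤k k≤q)

    fwd : Lsb (p ++ s) (q ++ r) k → ShortestBorder (q ++ s) k
    fwd l with at , min ← to Lsb⇔ l =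
      to (equiv ≤-refl) at , λ j<k hb → min j<k (from (equiv (<⇒≤ j<k)) hb)

    bwd : ShortestBorder (q ++ s) k → Lsb (p ++ s) (q ++ r) k
    bwd (hb , min) = from Lsb⇔
      (from (equiv ≤-refl) hb , λ j<k at → min j<k (to (equiv (<⇒≤ j<k)) at))

Lsb-unique : ∀ {u v k l} → Lsb u v k → Lsb u v l → k ≡ l
Lsb-unique (_ , _ , (ib , min) , refl) (_ , _ , (ib′ , min′) , refl) =
  ≤-antisym (min _ _ ib′) (min′ _ _ ib)

Lsb⇒>0 : ∀ {u v k} → Lsb u v k → 0 < k
Lsb⇒>0 (_ , _ , ((x≢[] , _) , _) , refl) = length>0 x≢[]

-- Swapping the components of an internal border of `(v , u)` gives an external border of `(u , v)`.
Lsb⇒MAB : ∀ {u v i j} → Lsb u v i → Lsb v u j → MAB u v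
Lsb⇒MAB (x , y , (ib , _) , _) (x′ , y′ , ((x′≢[] , s , p , x′∼y′) , _) , _) =
  (x , y , ib) ,
  -- If `y′` were empty, equality of lengths would make the nonempty `x′` empty.
  (y′ , x′ , (λ { refl → <⇒≢ (length>0 x′≢[]) (sym (∼⇒length≡ {x′} {[]} x′∼y′)) })
  , p , s , ∼-sym {x′} {y′} x′∼y′)

-- Counting pairs by their two shortest borders

-- Each `lsb` has at most one value, and that value is positive, so at most one term is 1. For
-- positive `i` and `j`, the ranges of summation express exactly `i + j ≤ n`.
mabᵈ≡∑ : ∀ n u v → ⟦ mabᵈ? n u v ⟧ ≡
  ∑₁ (n ∸ 1) (λ i → ∑₁ (n ∸ i) λ j → ⟦ lsb? u v i ⟧ * ⟦ lsb? v u j ⟧)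
mabᵈ≡∑ n u v = count (mabᵈ? n u v) (lsb? u v) (lsb? v u)
  where
  open ≡-Reasoning
  -- The deciders are abstracted because normalising the concrete ones is expensive.
  count : (m? : Dec (MABᵈ n u v)) (l? : ∀ k → Dec (Lsb u v k)) (l′? : ∀ k → Dec (Lsb v u k)) →
    ⟦ m? ⟧ ≡ ∑₁ (n ∸ 1) (λ i → ∑₁ (n ∸ i) λ j → ⟦ l? i ⟧ * ⟦ l′? j ⟧)
  count (yes (_ , zero  , _     , li , _)) _ _ = contradiction (Lsb⇒>0 li) λ ()
  count (yes (_ , suc i , zero  , _ , lj , _)) _ _ = contradiction (Lsb⇒>0 lj) λ ()
  count (yes (_ , suc i , suc j , li , lj , i+j≤n)) l? l′? = sym (begin
    ∑₁ (n ∸ 1) (λ i → ∑₁ (n ∸ i) λ j → ⟦ l? i ⟧ * ⟦ l′? j ⟧)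
      -- Other outer indices vanish through the first factor; in the next step other inner indices
      -- vanish through the second.
      ≡⟨ ∑-single (upTo⁺ (n ∸ 1)) (∈-upTo⁺ i<n-1) (λ {i′} i′≢i →
           ∑-zero (upTo (n ∸ suc i′)) λ {j′} _ → cong (_* ⟦ l′? (suc j′) ⟧)
             (⟦⟧-false (l? (suc i′)) λ l → i′≢i (suc-injective (Lsb-unique l li)))) ⟩
    ∑₁ (n ∸ suc i) (λ j → ⟦ l? (suc i) ⟧ * ⟦ l′? j ⟧)
      ≡⟨ ∑-single (upTo⁺ (n ∸ suc i)) (∈-upTo⁺ j<n-i) (λ {j′} j′≢j → trans
           (cong (⟦ l? (suc i) ⟧ *_)
             (⟦⟧-false (l′? (suc j′)) λ l → j′≢j (suc-injective (Lsb-unique l lj))))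
           (*-zeroʳ ⟦ l? (suc i) ⟧)) ⟩
    ⟦ l? (suc i) ⟧ * ⟦ l′? (suc j) ⟧
      ≡⟨ cong₂ _*_ (⟦⟧-true (l? (suc i)) li) (⟦⟧-true (l′? (suc j)) lj) ⟩
    1 ∎)
    where
    j+i≤n : suc j + suc i ≤ n
    j+i≤n = subst (_≤ n) (+-comm (suc i) (suc j)) i+j≤n
    -- The bound `n ∸ 1` leaves room for the other border, whose length `suc j` is at least 1.
    i<n-1 : i < n ∸ 1
    i<n-1 = ∸-monoˡ-≤ 1 (≤-trans (s≤s (m≤n+m (suc i) j)) j+i≤n)
    j<n-i : j < n ∸ suc i
    j<n-i = m+n≤o⇒m≤o∸n (suc j) j+i≤n
  count (no ¬m) l? l′? =
    sym (∑-zero (upTo (n ∸ 1)) λ {i} i∈ → ∑-zero (upTo (n ∸ suc i)) λ {j} j∈ →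
      term i j (∈-upTo⁻ i∈) (∈-upTo⁻ j∈))
    where
    term : ∀ i j → i < n ∸ 1 → j < n ∸ suc i → ⟦ l? (suc i) ⟧ * ⟦ l′? (suc j) ⟧ ≡ 0
    term i j i< j< with l? (suc i) | l′? (suc j)
    ... | no _   | _      = refl
    ... | yes _  | no _   = refl
    -- Since `suc i ≤ n`, the truncated difference in the bound on `j` is exact, and the two lengths
    -- add up to at most `n`.
    ... | yes li | yes lj = contradiction
      (Lsb⇒MAB li lj , suc i , suc j , li , lj ,
        ≤-trans (+-monoʳ-≤ (suc i) j<) (≤-reflexive (m+[n∸m]≡n (≤-trans i< (m∸n≤m n 1))))) ¬m

-- The count for two fixed border lengths

D≡∑ : ∀ m k j → D (m + k) j ≡ ∑ (words m) (λ x → ∑ (words k) λ y → ⟦ shortestBorder? (x ++ y) j ⟧)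
D≡∑ m k j = trans (length-filter≡∑ (λ w → shortestBorder? w j) (words (m + k))) (∑-words-+ m k _)

-- After re-pairing, one factor of the summand depends only on `q` and `s`, the other only on `p`
-- and `r`, so the fourfold sum is a product. The bound `j ≤ h` keeps the second border inside `r`
-- and `p`.
∑-lsb : ∀ h i j → 0 < h → 0 < i → j ≤ h →
  ∑ (words (h + i)) (λ u → ∑ (words (h + i)) λ v → ⟦ lsb? u v i ⟧ * ⟦ lsb? v u j ⟧)
    ≡ D (h + h) j * D (i + i) i
∑-lsb h i j 0<h 0<i j≤h = begin
  ∑ (words (h + i)) (λ u → ∑ (words (h + i)) λ v → ⟦ lsb? u v i ⟧ * ⟦ lsb? v u j ⟧)
    -- The cut of `u` falls `i` letters from its end, that of `v` falls `i` letters from its start,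
    -- hence the opposite order of summands.
    ≡⟨ cong (λ n → ∑ (words (h + i)) λ u → ∑ (words n) λ v → ⟦ lsb? u v i ⟧ * ⟦ lsb? v u j ⟧)
         (+-comm h i) ⟩
  ∑ (words (h + i)) (λ u → ∑ (words (i + h)) λ v → ⟦ lsb? u v i ⟧ * ⟦ lsb? v u j ⟧)
    ≡⟨ ∑-words-+ h i _ ⟩
  ∑ H (λ p → ∑ I λ s → ∑ (words (i + h)) λ v → ⟦ lsb? (p ++ s) v i ⟧ * ⟦ lsb? v (p ++ s) j ⟧)
    ≡⟨ (∑-cong H λ {p} p∈ → ∑-cong I λ {s} s∈ → trans (∑-words-+ i h _)
         (∑-cong I λ {q} q∈ → ∑-cong H λ {r} r∈ → re-pair p s q r
           (length-words h p∈) (length-words i s∈) (length-words i q∈) (length-words h r∈))) ⟩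
  ∑ H (λ p → ∑ I λ s → ∑ I λ q → ∑ H λ r → B q s * A p r)
    ≡⟨ (∑-cong H λ {p} _ → factor p) ⟩
  ∑ H (λ p → ∑ I (λ q → ∑ I (B q)) * ∑ H (A p))
    ≡⟨ ∑-*ˡ H (∑ I (λ q → ∑ I (B q))) _ ⟩
  ∑ I (λ q → ∑ I (B q)) * ∑ H (λ p → ∑ H (A p))
    ≡⟨ *-comm (∑ I (λ q → ∑ I (B q))) _ ⟩
  ∑ H (λ p → ∑ H (A p)) * ∑ I (λ q → ∑ I (B q))
    ≡⟨ cong₂ _*_ (D≡∑ h h j) (D≡∑ i i i) ⟨
  D (h + h) j * D (i + i) i ∎
  where
  open ≡-Reasoning
  H I : List Word
  H = words h
  I = words i
  A B : Word → Word → ℕ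
  A p r = ⟦ shortestBorder? (p ++ r) j ⟧
  B q s = ⟦ shortestBorder? (q ++ s) i ⟧

  re-pair : ∀ p s q r → length p ≡ h → length s ≡ i → length q ≡ i → length r ≡ h →
    ⟦ lsb? (p ++ s) (q ++ r) i ⟧ * ⟦ lsb? (q ++ r) (p ++ s) j ⟧ ≡ B q s * A p r
  re-pair p s q r ∣p∣ ∣s∣ ∣q∣ ∣r∣ = cong₂ _*_
    (⟦⟧-⇔ (lsb? (p ++ s) (q ++ r) i) (shortestBorder? (q ++ s) i)
      (Lsb⇔ShortestBorder p s q r (subst (0 <_) (sym ∣p∣) 0<h) (subst (0 <_) (sym ∣r∣) 0<h)
        (≤-reflexive (sym ∣s∣)) (≤-reflexive (sym ∣q∣))))
    -- For `(v , u)` the inner factors are `r` and `p`, both of length `h`.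
    (⟦⟧-⇔ (lsb? (q ++ r) (p ++ s) j) (shortestBorder? (p ++ r) j)
      (Lsb⇔ShortestBorder q r p s (subst (0 <_) (sym ∣q∣) 0<i) (subst (0 <_) (sym ∣s∣) 0<i)
        (subst (j ≤_) (sym ∣r∣) j≤h) (subst (j ≤_) (sym ∣p∣) j≤h)))

  factor : ∀ p → ∑ I (λ s → ∑ I λ q → ∑ H λ r → B q s * A p r)
             ≡ ∑ I (λ q → ∑ I (B q)) * ∑ H (A p)
  factor p = begin
    ∑ I (λ s → ∑ I λ q → ∑ H λ r → B q s * A p r)
      ≡⟨ ∑-comm I I _ ⟩
    ∑ I (λ q → ∑ I λ s → ∑ H λ r → B q s * A p r)
      ≡⟨ (∑-cong I λ {q} _ → ∑-cong I λ {s} _ → ∑-*ˡ H (B q s) (A p)) ⟩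
    ∑ I (λ q → ∑ I λ s → B q s * ∑ H (A p))
      ≡⟨ (∑-cong I λ {q} _ → ∑-*ʳ I (B q) _) ⟩
    ∑ I (λ q → ∑ I (B q) * ∑ H (A p))
      ≡⟨ ∑-*ʳ I (λ q → ∑ I (B q)) _ ⟩
    ∑ I (λ q → ∑ I (B q)) * ∑ H (A p) ∎

-- Putting `h = n ∸ i` gives `n = h + i` with `h` positive, which confines truncated subtraction to
-- this step.
∑-lsb-≤ : ∀ {n i j} → 0 < i → i < n → j ≤ n ∸ i →
  ∑ (words n) (λ u → ∑ (words n) λ v → ⟦ lsb? u v i ⟧ * ⟦ lsb? v u j ⟧)
    ≡ D (2 * n ∸ 2 * i) j * D (2 * i) i
∑-lsb-≤ {n} {i} {j} 0<i i<n j≤n-i = begin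
  ∑ (words n) (λ u → ∑ (words n) λ v → ⟦ lsb? u v i ⟧ * ⟦ lsb? v u j ⟧)
    ≡⟨ cong (λ n → ∑ (words n) λ u → ∑ (words n) λ v → ⟦ lsb? u v i ⟧ * ⟦ lsb? v u j ⟧)
         (m∸n+n≡m (<⇒≤ i<n)) ⟨
  ∑ (words (h + i)) (λ u → ∑ (words (h + i)) λ v → ⟦ lsb? u v i ⟧ * ⟦ lsb? v u j ⟧)
    ≡⟨ ∑-lsb h i j (m<n⇒0<n∸m i<n) 0<i j≤n-i ⟩
  D (h + h) j * D (i + i) i
    ≡⟨ cong₂ (λ m k → D m j * D k i)
         (trans (2* h) (*-distribˡ-∸ 2 n i)) (2* i) ⟩
  D (2 * n ∸ 2 * i) j * D (2 * i) i ∎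
  where
  open ≡-Reasoning
  h : ℕ
  h = n ∸ i
  2* : ∀ m → m + m ≡ 2 * m
  2* m = cong (m +_) (sym (+-identityʳ m))

mainTheorem2 : ∀ (n : ℕ) → 2 ≤ n →
    𝓜ᵈ n ≡ ∑₁ (n ∸ 1) (λ i → ∑₁ (n ∸ i) (λ j → D (2 * n ∸ 2 * i) j * D (2 * i) i))
mainTheorem2 n 2≤n = begin
  𝓜ᵈ n
    ≡⟨ length-filter≡∑ (uncurry (mabᵈ? n)) (cartesianProduct W W) ⟩
  ∑ (cartesianProduct W W) (λ uv → ⟦ uncurry (mabᵈ? n) uv ⟧)
    ≡⟨ ∑-cartesianProduct W W _ ⟩
  ∑ W (λ u → ∑ W λ v → ⟦ mabᵈ? n u v ⟧)
    ≡⟨ (∑-cong W λ {u} _ → ∑-cong W λ {v} _ → mabᵈ≡∑ n u v) ⟩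
  ∑ W (λ u → ∑ W λ v → ∑₁ (n ∸ 1) λ i → ∑₁ (n ∸ i) λ j → T i j u v)
    -- The range of `j` depends on `i`, so the sum over `i` moves outward first.
    ≡⟨ exchange (upTo (n ∸ 1)) (λ i u v → ∑₁ (n ∸ suc i) λ j → T (suc i) j u v) ⟩
  ∑₁ (n ∸ 1) (λ i → ∑ W λ u → ∑ W λ v → ∑₁ (n ∸ i) λ j → T i j u v)
    ≡⟨ (∑-cong (upTo (n ∸ 1)) λ {i} _ → exchange (upTo (n ∸ suc i)) λ j → T (suc i) (suc j)) ⟩
  ∑₁ (n ∸ 1) (λ i → ∑₁ (n ∸ i) λ j → ∑ W λ u → ∑ W λ v → T i j u v)
    -- The entries of `upTo` start at 0, so the lengths are `suc i` and `suc j`; `j < n ∸ suc i` is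
    -- by definition the bound required of `suc j`.
    ≡⟨ (∑-cong (upTo (n ∸ 1)) λ {i} i∈ → ∑-cong (upTo (n ∸ suc i)) λ {j} j∈ →
          ∑-lsb-≤ (s≤s z≤n) (i+1<n (∈-upTo⁻ i∈)) (∈-upTo⁻ j∈)) ⟩
  ∑₁ (n ∸ 1) (λ i → ∑₁ (n ∸ i) (λ j → D (2 * n ∸ 2 * i) j * D (2 * i) i)) ∎
  where
  open ≡-Reasoning
  W : List Word
  W = words n
  T : ℕ → ℕ → Word → Word → ℕ
  T i j u v = ⟦ lsb? u v i ⟧ * ⟦ lsb? v u j ⟧

  exchange : ∀ ks (f : ℕ → Word → Word → ℕ) →
    ∑ W (λ u → ∑ W λ v → ∑ ks λ k → f k u v) ≡ ∑ ks (λ k → ∑ W λ u → ∑ W λ v → f k u v)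
  exchange ks f = trans (∑-cong W λ {u} _ → ∑-comm W ks _) (∑-comm W ks _)

  i+1<n : ∀ {i} → i < n ∸ 1 → suc i < n
  i+1<n {i} i< = subst (_≤ n) (+-comm (suc i) 1) (m≤o∸n⇒m+n≤o (suc i) (<⇒≤ 2≤n) i<)
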